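{- Let $G$ be an outerplanar map. Then the faces of $G$ can be non-repetitively coloured using at most five colours.
   Context: A finite sequence $a_1a_2\cdots a_n$ is called non-repetitive if it contains no two identical adjacent blocks, i.e. there are no $i$ and $m\ge 1$ with $i+2m-1\le n$ and $a_{i+j}=a_{i+m+j}$ for all $0\le j<m$. An outerplanar map is a plane graph embedded so that all vertices lie on the boundary of the outer face. A colouring of the faces of a planar map (including the outer face) is called non-repetitive if for every sequence $F_1,\dots,F_n$ of pairwise distinct faces such that $F_i$ and $F_{i+1}$ share an edge for each $i$, the sequence of colours of $F_1,\dots,F_n$ is non-repetitive. -}

module Defs where

open import Data.Bool using (Bool; not)
open import Data.Fin using (Fin)
open import Data.List using (List; []; _++_; map)
open import Data.List.Relation.Unary.Linked using (Linked)
open import Data.List.Relation.Unary.Unique.Propositional using (Unique)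
open import Data.Nat using (ℕ; _+_)
open import Data.Product using (Σ; ∃-syntax; _×_; map₂)
open import Data.Sum using (_⊎_)
open import Function using (_⇔_; _↔_; Inverse; StrictlySurjective)
open import Relation.Binary.Construct.Closure.Equivalence using (EqClosure)
open import Relation.Binary.PropositionalEquality using (_≡_; _≢_)
open import Relation.Nullary using (¬_)

NonRepetitive : {A : Set} → List A → Set
NonRepetitive {A} xs =
  ¬ (∃[ us ] ∃[ bs ] ∃[ ws ] (bs ≢ [] × xs ≡ us ++ bs ++ bs ++ ws))

-- A finite plane graph, possibly disconnected and possibly with loops and
-- multiple edges, given combinatorially (a rotation system together with its
-- faces).  Every edge consists of two oppositely oriented darts.
record PlaneGraph : Set where
  field
    #V #E #F #C : ℕ

  Vertex : Set
  Vertex = Fin #V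

  Dart : Set
  Dart = Fin #E × Bool

  Face : Set
  Face = Fin #F

  Component : Set
  Component = Fin #C

  rev : Dart → Dart
  rev = map₂ not

  field
    tail : Dart → Vertex

    -- The next dart clockwise around the common tail.
    rotation : Dart ↔ Dart

  turn : Dart → Dart
  turn = Inverse.to rotation

  Isolated : Vertex → Set
  Isolated v = ∀ d → tail d ≢ v

  Adjacent : Vertex → Vertex → Set
  Adjacent u v = ∃[ d ] (tail d ≡ u × tail (rev d) ≡ v)

  field
    -- The darts leaving a vertex form a single cycle of the rotation.
    tail-orbit : ∀ d d′ →
      tail d ≡ tail d′ ⇔ EqClosure (λ x y → turn x ≡ y) d d′

    component            : Vertex → Component
    component-surjective : StrictlySurjective _≡_ component
    component-connected  : ∀ u v →
      component u ≡ component v ⇔ EqClosure Adjacent u v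

    -- The face to the left of a dart.  Walking along d with this face on the
    -- left, one continues along turn (rev d).  A face of a disconnected graph
    -- may have several boundary walks, so only one direction is required.
    left      : Dart → Face
    left-walk : ∀ d → left (turn (rev d)) ≡ left d

    -- The face containing an isolated vertex.
    around : (v : Vertex) → .(Isolated v) → Face

    outer : Face

  _OnBoundaryOf_ : Vertex → Face → Set
  v OnBoundaryOf f =
    (∃[ d ] (tail d ≡ v × left d ≡ f)) ⊎ Σ (Isolated v) (λ i → around v i ≡ f)

  Meet : Face → Face → Set
  Meet f g = ∃[ u ] ∃[ v ]
    (u OnBoundaryOf f × v OnBoundaryOf g × component u ≡ component v)

  -- Planarity.  Let W be the number of boundary walks, i.e. of cycles of
  -- turn ∘ rev, plus one trivial walk for each isolated vertex.  A plane drawing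
  -- amounts to every component being drawn on a sphere, which is
  -- #V + W ≡ #E + 2 * #C, and the bipartite incidence graph between components
  -- and faces, with one edge per boundary walk, being a tree, which is
  -- connectedness and #C + #F ≡ W + 1.  In general #V + W ≤ #E + 2 * #C, and
  -- connectedness gives #C + #F ≤ W + 1, so given connectedness the two
  -- equations are together equivalent to Euler's formula.
  field
    faces-connected : ∀ f g → EqClosure Meet f g
    euler           : #V + #F ≡ #E + #C + 1

  ShareEdge : Face → Face → Set
  ShareEdge f g = ∃[ d ] (left d ≡ f × left (rev d) ≡ g)

  Outerplanar : Set
  Outerplanar = ∀ v → v OnBoundaryOf outer

  NonRepetitiveColouring : {K : Set} → (Face → K) → Set
  NonRepetitiveColouring colour =
    ∀ (fs : List Face) → Unique fs → Linked ShareEdge fs →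
    NonRepetitive (map colour fs)

{-# OPTIONS --safe #-}

-- The dual graph of an outerplanar map without its outer face is a forest, and
-- a path in a rooted forest first approaches the root and then moves away from
-- it.  Colour the inner faces by their depth, following a square-free word on four
-- letters without factors x y x; a square along such a path would give a square
-- or an x y x in the word.  The outer face gets the fifth colour.
--
-- Euler's formula enters through trees and cotrees.  If T is a spanning forest
-- of the vertices, the edges outside T connect all faces; counting shows that
-- they form a tree.  For an outerplanar map, T can be chosen among the edges of
-- the outer face: otherwise the outer face could be split in two, giving one
-- face too many.  The tree of faces, rooted at the outer face, then contains all
-- edges between inner faces.
module Submission where

open import Defs
open import Data.Bool as Bool using (Bool; true; false; not; _xor_)
open import Data.Bool.Properties using (not-¬; not-injective; xor-assoc)
open import Data.Empty using (⊥)
open import Data.Fin as Fin using (Fin; zero; suc; toℕ; combine; join; splitAt; punchOut)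
open import Data.Fin.Patterns using (0F; 1F; 2F; 3F; 4F)
open import Data.Fin.Properties
  using (any?; pigeonhole; combine-injective; injective⇒≤; punchOut-injective; splitAt-join; join-splitAt)
open import Data.List using (List; []; _∷_; _++_; length; map; allFin; applyUpTo; catMaybes)
open import Data.List.Membership.Propositional using (_∈_)
open import Data.List.Membership.Propositional.Properties using (∈-allFin; ∈-map⁺; ∈-map⁻)
open import Data.List.Properties
  using (∷-injective; ∷-injectiveˡ; ∷-injectiveʳ; ++-assoc; catMaybes-++; length-applyUpTo;
         map-++; map-∘; map-applyUpTo; map-injective)
open import Data.List.Relation.Unary.All as All using (All; []; _∷_)
import Data.List.Relation.Unary.All.Properties as All
open import Data.List.Relation.Unary.AllPairs using ([]; _∷_)
open import Data.List.Relation.Unary.Any using (here; there)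
open import Data.List.Relation.Unary.Linked using (Linked; []; [-]; _∷_)
open import Data.List.Relation.Unary.Unique.Propositional using (Unique)
open import Data.Maybe using (Maybe; just; nothing; maybe′)
open import Data.Maybe.Properties as Maybe using (just-injective)
open import Data.Nat
open import Data.Nat.Induction using (<-wellFounded)
open import Data.Nat.Properties
open import Data.Nat.Tactic.RingSolver using (solve-∀)
open import Data.Product as Product using (Σ-syntax; ∃-syntax; _×_; _,_; proj₁; proj₂; map₂)
open import Data.Product.Properties using () renaming (≡-dec to ×-≡-dec)
open import Data.Sum as Sum using (_⊎_; inj₁; inj₂; [_,_]′)
open import Data.Sum.Properties using (inj₁-injective; inj₂-injective)
open import Data.Unit using (⊤; tt)
open import Function using (_∘_; id; Equivalence; Inverse)
open import Induction.WellFounded using (Acc; acc)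
open import Relation.Binary using (DecidableEquality; tri<; tri≈; tri>)
open import Relation.Binary.Construct.Closure.Equivalence as Eq using (EqClosure)
open import Relation.Binary.Construct.Closure.ReflexiveTransitive using (ε; _◅_; _◅◅_)
open import Relation.Binary.Construct.Closure.Symmetric using (fwd; bwd)
open import Relation.Binary.PropositionalEquality
open import Relation.Nullary using (¬_; Dec; yes; no; contradiction)
open import Relation.Nullary.Decidable using (map′; _×-dec_; _⊎-dec_; ¬?)
open import Relation.Unary using (Decidable)

SquareFree : {A : Set} → (ℕ → A) → Set
SquareFree f = ∀ i m → 1 ≤ m → ¬ (∀ j → j < m → f (i + j) ≡ f (i + m + j))

-- The Thue–Morse word

odd : ℕ → Bool
odd zero    = false
odd (suc n) = not (odd n)

odd-+ : ∀ m n → odd (m + n) ≡ odd m xor odd n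
odd-+ zero    n = refl
odd-+ (suc m) n rewrite odd-+ m n with odd m | odd n
... | true  | true  = refl
... | true  | false = refl
... | false | _     = refl

odd-double : ∀ n → odd (n + n) ≡ false
odd-double n rewrite odd-+ n n with odd n
... | true  = refl
... | false = refl

halve : ∀ n → (∃[ h ] n ≡ h + h) ⊎ (∃[ h ] n ≡ suc (h + h))
halve zero = inj₁ (0 , refl)
halve (suc n) with halve n
... | inj₁ (h , eq) = inj₂ (h , cong suc eq)
... | inj₂ (h , eq) = inj₁ (suc h , cong suc (trans eq (sym (+-suc h h))))

⌊1+n+n/2⌋≡n : ∀ n → ⌊ suc (n + n) /2⌋ ≡ n
⌊1+n+n/2⌋≡n zero    = refl
⌊1+n+n/2⌋≡n (suc n) rewrite +-suc n n = cong suc (⌊1+n+n/2⌋≡n n)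

-- The first argument is fuel; any value that is at least the index will do.
digitParity : ℕ → ℕ → Bool
digitParity zero    n = false
digitParity (suc k) n = odd n xor digitParity k ⌊ n /2⌋

digitParity-0 : ∀ k → digitParity k 0 ≡ false
digitParity-0 zero    = refl
digitParity-0 (suc k) = digitParity-0 k

digitParity-fuel : ∀ {k l n} → n ≤ k → n ≤ l → digitParity k n ≡ digitParity l n
digitParity-fuel {k} {l} {zero} _ _ = trans (digitParity-0 k) (sym (digitParity-0 l))
digitParity-fuel {suc k} {suc l} {suc n} (s≤s n≤k) (s≤s n≤l) =
  cong (odd (suc n) xor_) (digitParity-fuel (≤-trans half≤n n≤k) (≤-trans half≤n n≤l))
  where
  half≤n : ⌊ suc n /2⌋ ≤ n
  half≤n = s≤s⁻¹ (⌊n/2⌋<n n)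

thueMorse : ℕ → Bool
thueMorse n = digitParity n n

thueMorse-even : ∀ n → thueMorse (n + n) ≡ thueMorse n
thueMorse-even zero = refl
thueMorse-even (suc n)
  rewrite odd-double (suc n) | sym (n≡⌊n+n/2⌋ (suc n)) =
  digitParity-fuel (m≤n+m (suc n) n) ≤-refl

thueMorse-odd : ∀ n → thueMorse (suc (n + n)) ≡ not (thueMorse n)
thueMorse-odd n
  rewrite odd-double n | ⌊1+n+n/2⌋≡n n =
  cong not (digitParity-fuel (m≤m+n n n) ≤-refl)

-- The letter at an even position is followed by its own negation, so equal neighbours never start
-- there.
thueMorse-step : ∀ n → thueMorse n ≡ thueMorse (suc n) → odd n ≡ true
thueMorse-step n eq with halve n
... | inj₂ (h , refl) = cong not (odd-double h)
... | inj₁ (h , refl) = contradiction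
  (trans (sym (thueMorse-even h)) (trans eq (thueMorse-odd h))) (not-¬ refl)

-- Serves odd periods: unless two neighbours agree, every step negates the letter, and parity alone
-- fixes the letter `n` steps on.
alternating : ∀ (f : ℕ → Bool) i n →
  (∃[ j ] (j < n × f (i + j) ≡ f (suc (i + j)))) ⊎ f (i + n) ≡ odd n xor f i
alternating f i zero = inj₂ (cong f (+-identityʳ i))
alternating f i (suc n) with alternating f i n
... | inj₁ (j , j<n , eq) = inj₁ (j , m<n⇒m<1+n j<n , eq)
... | inj₂ eq rewrite +-suc i n with f (i + n) in eq₁ | f (suc (i + n)) in eq₂
...   | true  | true  = inj₁ (n , ≤-refl , trans eq₁ (sym eq₂))
...   | false | false = inj₁ (n , ≤-refl , trans eq₁ (sym eq₂))
...   | true  | false = inj₂ (trans (cong not eq) (sym (xor-assoc true (odd n) (f i))))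
...   | false | true  = inj₂ (trans (cong not eq) (sym (xor-assoc true (odd n) (f i))))

-- An even period is halved; an odd one shifts a pair of equal neighbours, which
-- can only start at an odd position, to an even position.
thueMorse-overlapFree : ∀ i m → Acc _<_ m → 1 ≤ m →
  ¬ (∀ j → j ≤ m → thueMorse (i + j) ≡ thueMorse (i + m + j))
thueMorse-overlapFree i m (acc rec) 1≤m periodic with halve m
... | inj₁ (suc p , refl) with halve i
...   | inj₁ (h , refl) = thueMorse-overlapFree h (suc p) (rec (m<m+n (suc p) z<s)) z<s
  λ j j≤ → trans (sym (thueMorse-even (h + j)))
    (trans (trans (cong thueMorse (e₁ h j))
      (trans (periodic (j + j) (+-mono-≤ j≤ j≤)) (cong thueMorse (e₂ h (suc p) j))))
    (thueMorse-even (h + suc p + j)))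
  where
  e₁ : ∀ h j → (h + j) + (h + j) ≡ (h + h) + (j + j)
  e₁ = solve-∀
  e₂ : ∀ h p j → (h + h) + (p + p) + (j + j) ≡ (h + p + j) + (h + p + j)
  e₂ = solve-∀
...   | inj₂ (h , refl) = thueMorse-overlapFree h (suc p) (rec (m<m+n (suc p) z<s)) z<s
  λ j j≤ → not-injective (trans (sym (thueMorse-odd (h + j)))
    (trans (trans (cong thueMorse (e₁ h j))
      (trans (periodic (j + j) (+-mono-≤ j≤ j≤)) (cong thueMorse (e₂ h (suc p) j))))
    (thueMorse-odd (h + suc p + j))))
  where
  e₁ : ∀ h j → suc ((h + j) + (h + j)) ≡ suc (h + h) + (j + j)
  e₁ = solve-∀
  e₂ : ∀ h p j → suc (h + h) + (p + p) + (j + j) ≡ suc ((h + p + j) + (h + p + j))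
  e₂ = solve-∀
thueMorse-overlapFree i m (acc rec) 1≤m periodic | inj₂ (p , refl)
  with alternating thueMorse i m
-- Without equal neighbours an odd number of steps negates the letter, whereas `periodic 0`
-- preserves it.
... | inj₂ eq rewrite odd-double p = not-¬ refl
  (trans (trans (cong thueMorse (sym (+-identityʳ i)))
    (trans (periodic 0 z≤n) (cong thueMorse (+-identityʳ (i + m))))) eq)
... | inj₁ (j , j<m , eq) = contradiction
  (trans (trans (sym odd₂) (trans (cong odd (e i m j)) (odd-+ (i + j) m)))
    (cong₂ _xor_ odd₁ (cong not (odd-double p))))
  λ ()
  where
  e : ∀ i m j → i + m + j ≡ i + j + m
  e = solve-∀
  odd₁ : odd (i + j) ≡ true
  odd₁ = thueMorse-step (i + j) eq
  odd₂ : odd (i + m + j) ≡ true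
  -- The index `suc j` may equal `m`: this is where the extra letter of the overlap is used.
  odd₂ = thueMorse-step (i + m + j)
    (trans (sym (periodic j (<⇒≤ j<m))) (trans eq
      (trans (cong thueMorse (sym (+-suc i j)))
        (trans (periodic (suc j) j<m) (cong thueMorse (+-suc (i + m) j))))))

-- A ternary square-free word

-- The three values encode the differences 1, -1 and 0 of two bits. Applied to neighbours in the
-- Thue-Morse word they give the classical ternary square-free word.
change : Bool → Bool → Maybe Bool
change false true  = just true
change true  false = just false
change _     _     = nothing

change-determines : ∀ {a a′ b b′} → a ≡ b → change a a′ ≡ change b b′ → a′ ≡ b′
change-determines {true}  {true}  {b′ = true}  refl _ = refl
change-determines {true}  {false} {b′ = false} refl _ = refl
change-determines {false} {true}  {b′ = true}  refl _ = refl
change-determines {false} {false} {b′ = false} refl _ = refl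

change-from-different : ∀ {a a′ b b′} →
  a ≢ b → change a a′ ≡ change b b′ → a′ ≡ a × b′ ≡ b
change-from-different {true}  {b = true}  a≢b _ = contradiction refl a≢b
change-from-different {false} {b = false} a≢b _ = contradiction refl a≢b
change-from-different {true}  {true}  {false} {false} _ _ = refl , refl
change-from-different {false} {false} {true}  {true}  _ _ = refl , refl
change-from-different {true}  {false} {false} {true} _ ()
change-from-different {false} {true}  {true}  {false} _ ()

changes : (ℕ → Bool) → ℕ → Maybe Bool
changes f n = change (f n) (f (suc n))

-- Two runs of f with the same changes coincide if they start alike, and are
-- constant otherwise, as a change determines its endpoints.
module _ (f : ℕ → Bool) (i m : ℕ)
         (square : ∀ j → j < m → changes f (i + j) ≡ changes f (i + m + j)) where

  private
    next : ∀ j → j < m →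
      change (f (i + j)) (f (i + suc j)) ≡ change (f (i + m + j)) (f (i + m + suc j))
    next j j<m rewrite +-suc i j | +-suc (i + m) j = square j j<m

  changes-constant : f i ≢ f (i + m) → ∀ j → j ≤ m →
    f (i + j) ≡ f i × f (i + m + j) ≡ f (i + m)
  changes-constant ≢₀ zero _ = cong f (+-identityʳ i) , cong f (+-identityʳ (i + m))
  changes-constant ≢₀ (suc j) j<m with changes-constant ≢₀ j (<⇒≤ j<m)
  ... | e , e′ with change-from-different (λ eq → ≢₀ (trans (sym e) (trans eq e′))) (next j j<m)
  ...   | d , d′ = trans d e , trans d′ e′

  changes-coincide : f i ≡ f (i + m) → ∀ j → j ≤ m → f (i + j) ≡ f (i + m + j)
  changes-coincide ≡₀ zero _ =
    trans (cong f (+-identityʳ i)) (trans ≡₀ (cong f (sym (+-identityʳ (i + m)))))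
  changes-coincide ≡₀ (suc j) j<m =
    change-determines (changes-coincide ≡₀ j (<⇒≤ j<m)) (next j j<m)

ternary : ℕ → Maybe Bool
ternary = changes thueMorse

ternary-squareFree : SquareFree ternary
ternary-squareFree i m 1≤m square with thueMorse i Bool.≟ thueMorse (i + m)
... | yes eq = thueMorse-overlapFree i m (<-wellFounded m) 1≤m
  (changes-coincide thueMorse i m square eq)
-- The first run is constant and ends at `i + m`, where the second begins, so the two would start
-- alike after all.
... | no ≢₀ = ≢₀ (sym (proj₁ (changes-constant thueMorse i m square ≢₀ m ≤-refl)))

-- Squares in lists and in infinite words

applyUpTo-++⁻ : {A : Set} (f : ℕ → A) (n : ℕ) (xs ys : List A) → applyUpTo f n ≡ xs ++ ys →
  xs ≡ applyUpTo f (length xs) × ys ≡ applyUpTo (λ j → f (length xs + j)) (length ys)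
applyUpTo-++⁻ f n       []       ys refl =
  refl , cong (applyUpTo f) (sym (length-applyUpTo f n))
applyUpTo-++⁻ f (suc n) (x ∷ xs) ys eq with ∷-injective eq
... | refl , eq′ with applyUpTo-++⁻ (f ∘ suc) n xs ys eq′
...   | e , e′ = cong (f 0 ∷_) e , e′

applyUpTo-injective : {A : Set} {f g : ℕ → A} {n : ℕ} →
  applyUpTo f n ≡ applyUpTo g n → ∀ j → j < n → f j ≡ g j
applyUpTo-injective eq zero    (s≤s _)   = ∷-injectiveˡ eq
applyUpTo-injective eq (suc j) (s≤s j<n) = applyUpTo-injective (∷-injectiveʳ eq) j j<n

applyUpTo-cong : {A : Set} {f g : ℕ → A} (n : ℕ) →
  (∀ j → j < n → f j ≡ g j) → applyUpTo f n ≡ applyUpTo g n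
applyUpTo-cong zero    f≡g = refl
applyUpTo-cong (suc n) f≡g = cong₂ _∷_ (f≡g 0 z<s) (applyUpTo-cong n (λ j j<n → f≡g (suc j) (s<s j<n)))

applyUpTo-square : {A : Set} (f : ℕ → A) (n : ℕ) (xs : List A) → applyUpTo f n ≡ xs ++ xs →
  ∀ j → j < length xs → f j ≡ f (length xs + j)
applyUpTo-square f n xs eq with applyUpTo-++⁻ f n xs xs eq
... | e , e′ = applyUpTo-injective (trans (sym e) e′)

applyUpTo-+ : {A : Set} (f : ℕ → A) (m n : ℕ) →
  applyUpTo f (m + n) ≡ applyUpTo f m ++ applyUpTo (λ j → f (m + j)) n
applyUpTo-+ f zero    n = refl
applyUpTo-+ f (suc m) n = cong (f 0 ∷_) (applyUpTo-+ (f ∘ suc) m n)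

squareFree⇒[] : {A : Set} {f : ℕ → A} → SquareFree f → ∀ i n xs →
  applyUpTo (λ j → f (i + j)) n ≡ xs ++ xs → xs ≡ []
squareFree⇒[] sf i n []         eq = refl
squareFree⇒[] {f = f} sf i n xs@(_ ∷ _) eq = contradiction
  (λ j j< → trans (applyUpTo-square (λ j → f (i + j)) n xs eq j j<)
    (cong f (sym (+-assoc i (length xs) j))))
  (sf i (length xs) z<s)

-- Separating a word into pairs of letters makes it free of palindromes

separate : {A : Set} → (ℕ → A) → ℕ → Maybe A
separate f 0 = just (f 0)
separate f 1 = just (f 1)
separate f 2 = nothing
separate f (suc (suc (suc n))) = separate (f ∘ (2 +_)) n

separate-prefix : {A : Set} (f : ℕ → A) (n : ℕ) →
  ∃[ n′ ] catMaybes (applyUpTo (separate f) n) ≡ applyUpTo f n′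
separate-prefix f 0 = 0 , refl
separate-prefix f 1 = 1 , refl
separate-prefix f 2 = 2 , refl
separate-prefix f (suc (suc (suc n))) =
  Product.map (2 +_) (cong (λ xs → f 0 ∷ f 1 ∷ xs)) (separate-prefix (f ∘ (2 +_)) n)

-- Erasing the separators maps factors of the separated word to factors of `f`, hence squares to
-- squares.
separate-factor : {A : Set} (f : ℕ → A) (i n : ℕ) → ∃[ i′ ] ∃[ n′ ]
  catMaybes (applyUpTo (λ j → separate f (i + j)) n) ≡ applyUpTo (λ j → f (i′ + j)) n′
separate-factor f 0 n = 0 , separate-prefix f n
separate-factor f 1 0 = 0 , 0 , refl
separate-factor f 1 1 = 1 , 1 , refl
separate-factor f 1 (suc (suc n)) =
  1 , Product.map suc (cong (f 1 ∷_)) (separate-prefix (f ∘ (2 +_)) n)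
separate-factor f 2 0 = 0 , 0 , refl
separate-factor f 2 (suc n) = 2 , separate-prefix (f ∘ (2 +_)) n
separate-factor f (suc (suc (suc i))) n = Product.map (2 +_) id (separate-factor (f ∘ (2 +_)) i n)

module _ {A : Set} where

  separate-xx : (f : ℕ → A) → (∀ n → f n ≢ f (suc n)) →
    ∀ i → separate f i ≢ separate f (suc i)
  separate-xx f f-xx 0 eq = f-xx 0 (just-injective eq)
  separate-xx f f-xx (suc (suc (suc i))) = separate-xx (f ∘ (2 +_)) (f-xx ∘ (2 +_)) i

  -- Of three consecutive letters exactly one is the separator. If it is the middle one, the outer
  -- two are neighbours in `f`; otherwise it is one of the outer two and differs from the other.
  separate-xyx : (f : ℕ → A) → (∀ n → f n ≢ f (suc n)) →
    ∀ i → separate f i ≢ separate f (2 + i)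
  separate-xyx f f-xx 1 eq = f-xx 1 (just-injective eq)
  separate-xyx f f-xx (suc (suc (suc i))) = separate-xyx (f ∘ (2 +_)) (f-xx ∘ (2 +_)) i

  squareFree⇒xx : {f : ℕ → A} → SquareFree f → ∀ n → f n ≢ f (suc n)
  squareFree⇒xx {f} sf n eq = sf n 1 ≤-refl λ where
    zero _ → trans (cong f (+-identityʳ n))
      (trans eq (cong f (sym (trans (+-identityʳ (n + 1)) (+-comm n 1)))))
    (suc _) (s≤s ())

  -- Erasing separators from a square leaves a square of `f`, which must be empty, so the block
  -- would consist of separators only. But two neighbours are never both separators, and a block of
  -- length one is excluded by `separate-xx`.
  separate-squareFree : (f : ℕ → A) → SquareFree f → SquareFree (separate f)
  separate-squareFree f sf i (suc zero) _ square =
    separate-xx f (squareFree⇒xx sf) i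
      (trans (cong (separate f) (sym (+-identityʳ i)))
        (trans (square 0 z<s) (cong (separate f) (trans (+-identityʳ (i + 1)) (+-comm i 1)))))
  separate-squareFree f sf i m@(suc (suc m-2)) _ square =
    both-letters (separate f (i + 0)) (separate f (i + 1))
      (applyUpTo (λ j → g (2 + j)) m-2) letters-vanish adjacent-differ
    where
    g : ℕ → Maybe A
    g j = separate f (i + j)
    block : List (Maybe A)
    block = applyUpTo g m
    factor : ∃[ i′ ] ∃[ n′ ] catMaybes (applyUpTo g (m + m)) ≡ applyUpTo (λ j → f (i′ + j)) n′
    factor = separate-factor f i (m + m)
    applyUpTo-double : applyUpTo g (m + m) ≡ block ++ block
    applyUpTo-double = trans (applyUpTo-+ g m m) (cong (block ++_) (sym (applyUpTo-cong m
      λ j j<m → trans (square j j<m) (cong (separate f) (+-assoc i m j)))))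
    letters-vanish : catMaybes block ≡ []
    letters-vanish = squareFree⇒[] {f = f} sf (proj₁ factor) (proj₁ (proj₂ factor)) (catMaybes block)
      (trans (sym (proj₂ (proj₂ factor)))
        (trans (cong catMaybes applyUpTo-double) (catMaybes-++ block block)))
    adjacent-differ : g 0 ≢ g 1
    adjacent-differ eq = separate-xx f (squareFree⇒xx sf) i
      (trans (cong (separate f) (sym (+-identityʳ i)))
        (trans eq (cong (separate f) (+-comm i 1))))
    both-letters : ∀ (x y : Maybe A) zs → catMaybes (x ∷ y ∷ zs) ≡ [] → ¬ (x ≢ y)
    both-letters nothing nothing zs _ x≢y = x≢y refl

-- Valleys

-- The absolute difference is spelled out as a sum on either side of `p`, so that the ring solver
-- can handle positions and heights.
Distance : ℕ → ℕ → ℕ → Set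
Distance j p a = p ≡ j + a ⊎ j ≡ p + a

∣-∣-distance : ∀ {j p a} → Distance j p a → ∣ j - p ∣ ≡ a
∣-∣-distance {j} {a = a} (inj₁ refl) = ∣m-m+n∣≡n j a
∣-∣-distance {p = p} {a} (inj₂ refl) = trans (∣-∣-comm (p + a) p) (∣m-m+n∣≡n p a)

module _ {A : Set} (f : ℕ → A) (sf : SquareFree f)
         (xyx : ∀ n → f n ≢ f (2 + n)) where

  private
    xx : ∀ n → f n ≢ f (suc n)
    xx = squareFree⇒xx sf

    xyx′ : ∀ k a → f (k + a) ≢ f (k + (2 + a))
    xyx′ k a eq = xyx (k + a) (trans eq (cong f (e k a)))
      where
      e : ∀ k a → k + (2 + a) ≡ 2 + (k + a)
      e = solve-∀

    xx′ : ∀ k a → f (k + a) ≢ f (k + suc a)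
    xx′ k a eq = xx (k + a) (trans eq (cong f (+-suc k a)))

    Square : ℕ → ℕ → ℕ → Set
    Square k p m = ∀ j → j < m → f (k + ∣ j - p ∣) ≡ f (k + ∣ m + j - p ∣)

    at : ∀ {k p m} → Square k p m → ∀ j {a b} → j < m →
      Distance j p a → Distance (m + j) p b → f (k + a) ≡ f (k + b)
    at square j j<m d d′ with ∣-∣-distance d | ∣-∣-distance d′
    ... | refl | refl = square j j<m

    ascending : ∀ k m → 1 ≤ m → ¬ Square k 0 m
    ascending k m 1≤m square = sf k m 1≤m λ j j<m → trans
      (at square j j<m (inj₂ refl) (inj₂ refl))
      (cong f (sym (+-assoc k m j)))

    -- Read backwards, a descending square is a factor of `f` starting at `k + r`, with the halves
    -- swapped; `j` counts from the end of a half and `i` from its beginning.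
    descending′ : ∀ {k n r} → Square k (n + (suc n + r)) (suc n) →
      ∀ j → ∃[ i ] j + i ≡ n → f (k + r + j) ≡ f (k + r + suc n + j)
    descending′ {k} {_} {r} square j (i , refl) = trans (cong f (e₁ k r j))
      (trans (sym (at square i {j + suc (j + i) + r} {j + r} (s≤s (m≤n+m i j))
        (inj₁ (e₂ i j r)) (inj₁ (e₃ i j r)))) (cong f (e₄ k r j i)))
      where
      e₁ : ∀ k r j → k + r + j ≡ k + (j + r)
      e₁ = solve-∀
      e₂ : ∀ i j r → j + i + (suc (j + i) + r) ≡ i + (j + suc (j + i) + r)
      e₂ = solve-∀
      e₃ : ∀ i j r → j + i + (suc (j + i) + r) ≡ suc (j + i) + i + (j + r)
      e₃ = solve-∀
      e₄ : ∀ k r j i → k + (j + suc (j + i) + r) ≡ k + r + suc (j + i) + j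
      e₄ = solve-∀

    descending : ∀ k n r → ¬ Square k (n + (suc n + r)) (suc n)
    descending k n r square = sf (k + r) (suc n) z<s
      λ j j≤n → descending′ square j (m≤n⇒∃[o]m+o≡n (s≤s⁻¹ j≤n))

    -- Positions `q` and `2 + q` flank the lowest point at height 1; their copies lie on the
    -- ascending slope, two apart, and carry equal letters.
    lowest-in-first : ∀ k q r → ¬ Square k (suc q) (3 + q + r)
    lowest-in-first k q r square = xyx′ k (2 + r + q) (trans
      (sym (at square q {1} (s≤s (m≤n⇒m≤1+n (m≤n⇒m≤1+n (m≤m+n q r))))
        (inj₁ (sym (+-comm q 1))) (inj₂ (e₁ q r))))
      (at square (2 + q) (s≤s (s≤s (s≤s (m≤m+n q r))))
        (inj₂ (e₂ q)) (inj₂ (e₃ q r))))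
      where
      e₁ : ∀ q r → 3 + q + r + q ≡ suc q + (2 + r + q)
      e₁ = solve-∀
      e₂ : ∀ q → 2 + q ≡ suc q + 1
      e₂ = solve-∀
      e₃ : ∀ q r → 3 + q + r + (2 + q) ≡ suc q + (2 + (2 + r + q))
      e₃ = solve-∀

    -- Here the positions flanking the lowest point are those at `r` and `2 + r` in the second half;
    -- their counterparts in the first half lie two apart on the descending slope.
    lowest-in-second : ∀ k n r → 3 + r ≤ suc n → ¬ Square k (2 + n + r) (suc n)
    lowest-in-second k n r 3+r≤1+n square = xyx′ k n (sym (trans
      (at square r (≤-trans (m≤n+m (suc r) 2) 3+r≤1+n) (inj₁ (e₁ n r)) (inj₁ (e₂ n r)))
      (sym (at square (2 + r) {n} {1} 3+r≤1+n (inj₁ (e₃ n r)) (inj₂ (e₄ n r))))))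
      where
      e₁ : ∀ n r → 2 + n + r ≡ r + (2 + n)
      e₁ = solve-∀
      e₂ : ∀ n r → 2 + n + r ≡ suc n + r + 1
      e₂ = solve-∀
      e₃ : ∀ n r → 2 + n + r ≡ 2 + r + n
      e₃ = solve-∀
      e₄ : ∀ n r → suc n + (2 + r) ≡ 2 + n + r + 1
      e₄ = solve-∀

    -- Position `j` of the first half has height `p - j`, its copy `1 + j`. Near the middle of the
    -- half these differ by one or two, depending on parity, and give x x or x y x.
    lowest-ends-first : ∀ k p → ¬ Square k p (suc p)
    lowest-ends-first k p with halve (suc p)
    ... | inj₁ (suc g , refl) = λ square → xyx′ k g
      (at square (suc g) (s≤s (m≤n+m (suc g) g)) (inj₁ (+-suc g g)) (inj₂ (e g)))
      where
      e : ∀ g → suc g + suc g + suc g ≡ g + suc g + (2 + g)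
      e = solve-∀
    ... | inj₂ (h , refl) = λ square → xx′ k h
      (at square h (s≤s (m≤m+n h h)) (inj₁ refl) (inj₂ (sym (+-suc (h + h) h))))

    -- The same with heights `m - j` and `j`.
    lowest-starts-second : ∀ k m → 1 ≤ m → ¬ Square k m m
    lowest-starts-second k m 1≤m with halve m
    ... | inj₁ (suc g , refl) = λ square → xyx′ k g
      (sym (at square g (s≤s (m≤m+n g (suc g))) (inj₁ (e g)) (inj₂ refl)))
      where
      e : ∀ g → suc g + suc g ≡ g + (2 + g)
      e = solve-∀
    ... | inj₂ (h , refl) = λ square → xx′ k h
      (sym (at square h (s≤s (m≤m+n h h)) (inj₁ (sym (+-suc h h))) (inj₂ refl)))

  -- Unless it is monotone, a square in a valley has its lowest point p inside
  -- one half, where x y x occurs around p and hence monotonically in the other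
  -- half, or at the middle, in which case the palindrome around the lowest point
  -- shifts to one around a point of a slope.
  valley-squareFree : ∀ k p m → 1 ≤ m →
    ¬ (∀ j → j < m → f (k + ∣ j - p ∣) ≡ f (k + ∣ m + j - p ∣))
  valley-squareFree k zero m 1≤m = ascending k m 1≤m
  valley-squareFree k p@(suc q) m@(suc n) 1≤m with <-cmp p m
  ... | tri≈ _ refl _ = lowest-starts-second k m 1≤m
  ... | tri< p<m _ _ with m≤n⇒m<n∨m≡n p<m
  ...   | inj₂ refl = lowest-ends-first k p
  ...   | inj₁ p+1<m with m≤n⇒∃[o]m+o≡n p+1<m
  ...     | r , refl = lowest-in-first k q r
  valley-squareFree k p@(suc q) m@(suc n) 1≤m | tri> _ _ m<p with m≤n⇒∃[o]m+o≡n m<p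
  -- Since `p` is `2 + n + r`, this asks whether `p + 1` is still a position of the square. If not,
  -- the square ends at `p` or earlier and only descends.
  ... | r , refl with 3 + r ≤? suc n
  ...   | yes 3+r≤1+n = lowest-in-second k n r 3+r≤1+n
  ...   | no ≰ with m≤n⇒∃[o]m+o≡n (s≤s⁻¹ (s≤s⁻¹ (≰⇒> ≰)))
  ...     | t , e = subst (λ p → ¬ Square k p m) lengths (descending k n t)
    where
    e′ : ∀ n t → n + (suc n + t) ≡ suc n + (n + t)
    e′ = solve-∀
    lengths : n + (suc n + t) ≡ p
    lengths = trans (e′ n t) (trans (cong (suc n +_) e) (+-suc (suc n) r))

word : ℕ → Maybe (Maybe Bool)
word = separate ternary

word-valley : ∀ k p m → 1 ≤ m →
  ¬ (∀ j → j < m → word (k + ∣ j - p ∣) ≡ word (k + ∣ m + j - p ∣))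
word-valley = valley-squareFree word (separate-squareFree ternary ternary-squareFree)
  (separate-xyx ternary (squareFree⇒xx ternary-squareFree))

-- Paths in rooted forests

map-≡-++ : {A B : Set} (f : A → B) (xs : List A) (ys zs : List B) → map f xs ≡ ys ++ zs →
  ∃[ xs₁ ] ∃[ xs₂ ] (xs ≡ xs₁ ++ xs₂ × map f xs₁ ≡ ys × map f xs₂ ≡ zs)
map-≡-++ f xs       []       zs eq = [] , xs , refl , refl , eq
map-≡-++ f (x ∷ xs) (y ∷ ys) zs eq with map-≡-++ f xs ys zs (∷-injectiveʳ eq)
... | xs₁ , xs₂ , refl , refl , eq₂ =
  x ∷ xs₁ , xs₂ , refl , cong (_∷ map f xs₁) (∷-injectiveˡ eq) , eq₂

module _ {A : Set} where

  Unique-++⁻ˡ : ∀ xs {ys : List A} → Unique (xs ++ ys) → Unique xs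
  Unique-++⁻ˡ []       _          = []
  Unique-++⁻ˡ (x ∷ xs) (px ∷ pxs) = All.++⁻ˡ xs px ∷ Unique-++⁻ˡ xs pxs

  Unique-++⁻ʳ : ∀ xs {ys : List A} → Unique (xs ++ ys) → Unique ys
  Unique-++⁻ʳ []       u       = u
  Unique-++⁻ʳ (x ∷ xs) (_ ∷ u) = Unique-++⁻ʳ xs u

  Unique-++⁻-≢ : ∀ xs {ys : List A} → Unique (xs ++ ys) → ∀ {x y} → x ∈ xs → y ∈ ys → x ≢ y
  Unique-++⁻-≢ (x ∷ xs) (px ∷ _) (here refl) y∈ys =
    All.lookup (All.++⁻ʳ xs px) y∈ys
  Unique-++⁻-≢ (x ∷ xs) (_ ∷ u) (there x∈xs) y∈ys = Unique-++⁻-≢ xs u x∈xs y∈ys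

  module _ {R : A → A → Set} where

    Linked-++⁻ˡ : ∀ xs {ys} → Linked R (xs ++ ys) → Linked R xs
    Linked-++⁻ˡ []           _        = []
    Linked-++⁻ˡ (x ∷ [])     _        = [-]
    Linked-++⁻ˡ (x ∷ y ∷ xs) (r ∷ rs) = r ∷ Linked-++⁻ˡ (y ∷ xs) rs

    Linked-++⁻ʳ : ∀ xs {ys} → Linked R (xs ++ ys) → Linked R ys
    Linked-++⁻ʳ []               rs       = rs
    Linked-++⁻ʳ (x ∷ []) {[]}    _        = []
    Linked-++⁻ʳ (x ∷ []) {_ ∷ _} (_ ∷ rs) = rs
    Linked-++⁻ʳ (x ∷ y ∷ xs)     (_ ∷ rs) = Linked-++⁻ʳ (y ∷ xs) rs

module _ {X : Set} (depth : X → ℕ) (parent : X → X) where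

  Child : X → X → Set
  Child x y = parent x ≡ y × depth x ≡ suc (depth y)

  TreeEdge : X → X → Set
  TreeEdge x y = Child x y ⊎ Child y x

  -- After a step down to a child there is no way back up: the only vertex above is the parent just
  -- left, and no vertex repeats.
  ascent : ∀ x y ys → Linked TreeEdge (y ∷ ys) → Unique (x ∷ y ∷ ys) → parent y ≡ x →
    map depth (y ∷ ys) ≡ applyUpTo (depth y +_) (suc (length ys))
  ascent x y [] _ _ _ = cong (_∷ []) (sym (+-identityʳ (depth y)))
  ascent x y (z ∷ zs) (inj₁ (y↑z , _) ∷ _) ((_ ∷ x≢z ∷ _) ∷ _) y↑x =
    contradiction (trans (sym y↑x) y↑z) x≢z
  ascent x y (z ∷ zs) (inj₂ (z↑y , z>y) ∷ path) (_ ∷ u) _ = cong₂ _∷_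
    (sym (+-identityʳ (depth y)))
    (trans (ascent y z zs path u z↑y) (applyUpTo-cong (suc (length zs))
      λ j _ → trans (cong (_+ j) z>y) (sym (+-suc (depth y) j))))

  -- `k` is the depth of the vertex nearest to the root and `p` its position on the path; each
  -- initial step towards the root raises `p` by one.
  valley : ∀ x xs → Linked TreeEdge (x ∷ xs) → Unique (x ∷ xs) → ∃[ k ] ∃[ p ]
    map depth (x ∷ xs) ≡ applyUpTo (λ i → k + ∣ i - p ∣) (suc (length xs))
  valley x [] _ _ = depth x , 0 , cong (_∷ []) (sym (+-identityʳ (depth x)))
  valley x (y ∷ ys) (inj₁ (x↑y , x>y) ∷ path) (_ ∷ u) with valley y ys path u
  ... | k , p , eq = k , suc p ,
    cong₂ _∷_ (trans x>y (trans (cong suc (∷-injectiveˡ eq)) (sym (+-suc k p)))) eq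
  valley x (y ∷ ys) (inj₂ (y↑x , y>x) ∷ path) u = depth x , 0 ,
    cong₂ _∷_ (sym (+-identityʳ (depth x)))
      (trans (ascent x y ys path u y↑x) (applyUpTo-cong (suc (length ys))
        λ j _ → trans (cong (_+ j) y>x) (sym (+-suc (depth x) j))))

  word-path : ∀ xs ys → Linked TreeEdge (xs ++ ys) → Unique (xs ++ ys) →
    map (word ∘ depth) xs ≡ map (word ∘ depth) ys → xs ≡ []
  word-path []           ys _    _ _  = refl
  word-path xs@(x ∷ xs′) ys path u eq with valley x (xs′ ++ ys) path u
  ... | k , p , depths = contradiction
    (applyUpTo-square (λ i → word (k + ∣ i - p ∣)) (suc (length (xs′ ++ ys)))
      (map (word ∘ depth) xs) square)
    (word-valley k p (length (map (word ∘ depth) xs)) z<s)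
    where
    n : ℕ
    n = suc (length (xs′ ++ ys))
    square : applyUpTo (λ i → word (k + ∣ i - p ∣)) n ≡
      map (word ∘ depth) xs ++ map (word ∘ depth) xs
    square = begin
      applyUpTo (λ i → word (k + ∣ i - p ∣)) n        ≡⟨ map-applyUpTo (λ i → k + ∣ i - p ∣) word n ⟨
      map word (applyUpTo (λ i → k + ∣ i - p ∣) n)    ≡⟨ cong (map word) depths ⟨
      map word (map depth (xs ++ ys))                 ≡⟨ map-∘ (xs ++ ys) ⟨
      map (word ∘ depth) (xs ++ ys)                   ≡⟨ map-++ (word ∘ depth) xs ys ⟩
      map (word ∘ depth) xs ++ map (word ∘ depth) ys  ≡⟨ cong (map (word ∘ depth) xs ++_) eq ⟨
      map (word ∘ depth) xs ++ map (word ∘ depth) xs  ∎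
      where open ≡-Reasoning

  module _ (_≟_ : DecidableEquality X) (root : X) where

    rootedColour : X → Maybe (Maybe (Maybe Bool))
    rootedColour x with x ≟ root
    ... | yes _ = nothing
    ... | no _  = just (word (depth x))

    rootedColour-root : ∀ x → x ≡ root → rootedColour x ≡ nothing
    rootedColour-root x x≡r with x ≟ root
    ... | yes _  = refl
    ... | no x≢r = contradiction x≡r x≢r

    rootedColour-nothing : ∀ x → rootedColour x ≡ nothing → x ≡ root
    rootedColour-nothing x eq with x ≟ root
    ... | yes x≡r = x≡r

    rootedColour-just : ∀ x → x ≢ root → rootedColour x ≡ just (word (depth x))
    rootedColour-just x x≢r with x ≟ root
    ... | yes x≡r = contradiction x≡r x≢r
    ... | no _    = refl

    map-rootedColour : ∀ xs → All (_≢ root) xs → map rootedColour xs ≡ map just (map (word ∘ depth) xs)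
    map-rootedColour []       []        = refl
    map-rootedColour (x ∷ xs) (px ∷ pxs) = cong₂ _∷_ (rootedColour-just x px) (map-rootedColour xs pxs)

    module _ (E : X → X → Set)
             (tree : ∀ {x y} → E x y → x ≢ root → y ≢ root → x ≢ y → TreeEdge x y) where

      treePath : ∀ xs → Linked E xs → Unique xs → All (_≢ root) xs → Linked TreeEdge xs
      treePath []           _        _                _              = []
      treePath (x ∷ [])     _        _                _              = [-]
      treePath (x ∷ y ∷ xs) (e ∷ es) ((x≢y ∷ _) ∷ u) (px ∷ py ∷ ps) =
        tree e px py x≢y ∷ treePath (y ∷ xs) es u (py ∷ ps)

      -- The colour of the root is used only once, so it cannot occur in a square.
      rootedColour-squareFree : ∀ xs ys → Linked E (xs ++ ys) → Unique (xs ++ ys) →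
        map rootedColour xs ≡ map rootedColour ys → xs ≡ []
      rootedColour-squareFree xs ys path u eq =
        word-path xs ys (treePath (xs ++ ys) path u (All.++⁺ xs≢r ys≢r)) u
          (map-injective just-injective (trans (sym (map-rootedColour xs xs≢r))
            (trans eq (map-rootedColour ys ys≢r))))
        where
        rootAgain : ∀ {xs ys} → map rootedColour xs ≡ map rootedColour ys → root ∈ xs → root ∈ ys
        rootAgain {xs} {ys} eq r∈xs
          with ∈-map⁻ rootedColour (subst (rootedColour root ∈_) eq (∈-map⁺ rootedColour r∈xs))
        ... | y , y∈ys , c≡ = subst (_∈ ys)
          (rootedColour-nothing y (trans (sym c≡) (rootedColour-root root refl))) y∈ys
        xs≢r : All (_≢ root) xs
        xs≢r = All.tabulate λ x∈xs x≡r → let r∈xs = subst (_∈ xs) x≡r x∈xs in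
          Unique-++⁻-≢ xs u r∈xs (rootAgain eq r∈xs) refl
        ys≢r : All (_≢ root) ys
        ys≢r = All.tabulate λ y∈ys y≡r → let r∈ys = subst (_∈ ys) y≡r y∈ys in
          Unique-++⁻-≢ xs u (rootAgain (sym eq) r∈ys) r∈ys refl

      rootedColour-nonRepetitive : {K : Set} (name : Maybe (Maybe (Maybe Bool)) → K) →
        (∀ {a b} → name a ≡ name b → a ≡ b) →
        ∀ xs → Unique xs → Linked E xs → NonRepetitive (map (name ∘ rootedColour) xs)
      rootedColour-nonRepetitive name name-injective xs u path (us , bs , ws , bs≢[] , eq)
        with map-≡-++ (name ∘ rootedColour) xs us (bs ++ bs ++ ws) eq
      ... | xs₁ , xs₂ , refl , _ , eq₂ with map-≡-++ (name ∘ rootedColour) xs₂ bs (bs ++ ws) eq₂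
      ...   | ys , xs₃ , refl , ys≡ , eq₃ with map-≡-++ (name ∘ rootedColour) xs₃ bs ws eq₃
      ...     | zs , xs₄ , refl , zs≡ , _ = bs≢[] (trans (sym ys≡)
        (cong (map (name ∘ rootedColour)) (rootedColour-squareFree ys zs
          (factor Linked-++⁻ˡ Linked-++⁻ʳ path) (factor Unique-++⁻ˡ Unique-++⁻ʳ u)
          (map-injective name-injective
            (trans (sym (map-∘ ys)) (trans (trans ys≡ (sym zs≡)) (map-∘ zs)))))))
        where
        factor : {P : List X → Set} → (∀ xs {ys} → P (xs ++ ys) → P xs) →
          (∀ xs {ys} → P (xs ++ ys) → P ys) → P (xs₁ ++ ys ++ zs ++ xs₄) → P (ys ++ zs)
        factor {P} prefix suffix p =
          prefix (ys ++ zs) (subst P (sym (++-assoc ys zs xs₄)) (suffix xs₁ p))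

-- Finite sets

least : {Q : ℕ → Set} → Decidable Q → ∀ k → Q k → ∃[ l ] (Q l × (∀ {j} → Q j → l ≤ j))
least {Q} Q? k q with Q? 0
... | yes q₀ = 0 , q₀ , λ _ → z≤n
least {Q} Q? zero q | no ¬q₀ = contradiction q ¬q₀
least {Q} Q? (suc k) q | no ¬q₀ with least (Q? ∘ suc) k q
... | l , ql , min = suc l , ql , minimal _
  where
  minimal : ∀ j → Q j → suc l ≤ j
  minimal zero    q₀ = contradiction q₀ ¬q₀
  minimal (suc j) qj = s≤s (min qj)

bounded : ∀ {n} (f : Fin n → ℕ) → ∃[ b ] (∀ i → f i ≤ b)
bounded {zero}  f = 0 , λ ()
bounded {suc n} f with bounded (f ∘ suc)
... | b , f≤b = f zero ⊔ b , λ where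
  zero    → m≤m⊔n (f zero) b
  (suc i) → ≤-trans (f≤b i) (m≤n⊔m (f zero) b)

injective⇒surjective : ∀ {n} {f : Fin n → Fin n} → (∀ {i j} → f i ≡ f j → i ≡ j) →
  ∀ y → ∃[ x ] f x ≡ y
injective⇒surjective {suc n} {f} f-inj y with any? (λ x → f x Fin.≟ y)
... | yes hit = hit
... | no miss = contradiction
  (injective⇒≤ {f = λ x → punchOut (avoid x)} λ eq → f-inj (punchOut-injective (avoid _) (avoid _) eq))
  1+n≰n
  where
  avoid : ∀ x → y ≢ f x
  avoid x eq = miss (x , sym eq)

anyBool? : {Q : Bool → Set} → Decidable Q → Dec (∃[ b ] Q b)
anyBool? Q? = map′ [ (false ,_) , (true ,_) ]′
  (λ where (false , q) → inj₁ q
           (true  , q) → inj₂ q)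
  (Q? false ⊎-dec Q? true)

-- Rooted spanning forests

module _ {e : ℕ} where

  reverse : Fin e × Bool → Fin e × Bool
  reverse = map₂ not

  same-edge : ∀ (d d′ : Fin e × Bool) → proj₁ d ≡ proj₁ d′ → d ≡ d′ ⊎ d ≡ reverse d′
  same-edge (i , true)  (_ , true)  refl = inj₁ refl
  same-edge (i , true)  (_ , false) refl = inj₂ refl
  same-edge (i , false) (_ , true)  refl = inj₂ refl
  same-edge (i , false) (_ , false) refl = inj₁ refl

  reverse² : ∀ d → reverse (reverse d) ≡ d
  reverse² (i , true)  = refl
  reverse² (i , false) = refl

  module _ {X : Set} (src : Fin e × Bool → X) (P : Fin e → Set) where

    Link : X → X → Set
    Link x y = ∃[ d ] (P (proj₁ d) × src d ≡ x × src (reverse d) ≡ y)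

    Link-symmetric : ∀ {x y} → Link x y → Link y x
    Link-symmetric (d , p , s , t) = reverse d , p , t , trans (cong src (reverse² d)) s

  linked : ∀ {X : Set} {src : Fin e × Bool → X} {P : Fin e → Set} d → P (proj₁ d) →
    EqClosure (Link src P) (src d) (src (reverse d))
  linked d p = Eq.return (d , p , refl , refl)

  -- Breadth-first search: `depth` is the distance to the nearest root along edges in `P`, and a
  -- parent lies one step nearer.
  module Forest {n : ℕ} (src : Fin e × Bool → Fin n) (P : Fin e → Set) (P? : Decidable P)
                (Root : Fin n → Set) (Root? : Decidable Root)
                (reach : ∀ x → ∃[ r ] (Root r × EqClosure (Link src P) x r)) where

    Within : ℕ → Fin n → Set
    Within zero    x = Root x
    Within (suc k) x = Root x ⊎
      (∃[ i ] ∃[ b ] (P i × src (i , b) ≡ x × Within k (src (i , not b))))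

    Within? : ∀ x k → Dec (Within k x)
    Within? x zero    = Root? x
    Within? x (suc k) = Root? x ⊎-dec any? λ i → anyBool? λ b →
      P? i ×-dec (src (i , b) Fin.≟ x) ×-dec Within? (src (i , not b)) k

    within : ∀ {x r} → Root r → EqClosure (Link src P) x r → ∃[ k ] Within k x
    within r ε = 0 , r
    within r (fwd ((i , b) , p , s , refl) ◅ path) =
      Product.map suc (λ w → inj₂ (i , b , p , s , w)) (within r path)
    within r (bwd l ◅ path) with Link-symmetric src P l
    ... | (i , b) , p , s , refl =
      Product.map suc (λ w → inj₂ (i , b , p , s , w)) (within r path)

    abstract
      leastDepth : ∀ x → ∃[ l ] (Within l x × (∀ {j} → Within j x → l ≤ j))
      leastDepth x with reach x
      ... | _ , r , path = let k , w = within r path in least (Within? x) k w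

      depth : Fin n → ℕ
      depth x = proj₁ (leastDepth x)

    ParentDart : Fin n → Fin e × Bool → Set
    ParentDart x d = P (proj₁ d) × src d ≡ x × depth x ≡ suc (depth (src (reverse d)))

    abstract
      parentDart : ∀ x → Root x ⊎ (∃[ d ] ParentDart x d)
      parentDart x with leastDepth x
      ... | zero  , r , _ = inj₁ r
      ... | suc k , inj₁ r , _ = inj₁ r
      ... | suc k , inj₂ (i , b , p , s , w) , min = inj₂ ((i , b) , p , s ,
        -- By `w` the neighbour has depth at most `k`; if it were less, `x` would be nearer to a
        -- root than `suc k`.
        cong suc (≤-antisym
          (s≤s⁻¹ (min (inj₂ (i , b , p , s , proj₁ (proj₂ (leastDepth (src (i , not b))))))))
          (proj₂ (proj₂ (leastDepth (src (i , not b)))) w)))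

      parentEdge : Fin n → Maybe (Fin e)
      parentEdge x = [ (λ _ → nothing) , (λ (d , _) → just (proj₁ d)) ]′ (parentDart x)

      parent : Fin n → Fin n
      parent x = [ (λ _ → x) , (λ (d , _) → src (reverse d)) ]′ (parentDart x)

      parentEdge-nothing : ∀ {x} → parentEdge x ≡ nothing → Root x
      parentEdge-nothing {x} eq with parentDart x
      ... | inj₁ r = r

      parentEdge-just : ∀ {x i} → parentEdge x ≡ just i →
        ∃[ d ] (ParentDart x d × proj₁ d ≡ i × parent x ≡ src (reverse d))
      parentEdge-just {x} eq with parentDart x
      ... | inj₂ (d , pd) = d , pd , just-injective eq , refl

    parentEdge-P : ∀ {x i} → parentEdge x ≡ just i → P i
    parentEdge-P eq with parentEdge-just eq
    ... | d , (p , _) , refl , _ = p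

    -- If an edge were the parent edge of both its ends, each would be deeper than the other.
    parentEdge-injective : ∀ {x y i} → parentEdge x ≡ just i → parentEdge y ≡ just i → x ≡ y
    parentEdge-injective eq eq′ with parentEdge-just eq | parentEdge-just eq′
    ... | d , (_ , refl , x>) , refl , _ | d′ , (_ , refl , y>) , e , _ with same-edge d′ d e
    ...   | inj₁ refl = refl
    ...   | inj₂ refl = contradiction
      (trans x> (cong suc (trans y> (cong (suc ∘ depth ∘ src) (reverse² d)))))
      (m≢1+n+m _ {1})

  -- Union-find over the list of edges. Comparing classes decides connectedness along `P`, which
  -- `EqClosure` alone does not.
  classes : ∀ {n} (src : Fin e × Bool → Fin n) {P : Fin e → Set} → Decidable P → (is : List (Fin e)) →
    Σ[ class ∈ (Fin n → Fin n) ]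
      ((∀ {i} → i ∈ is → P i → class (src (i , false)) ≡ class (src (i , true))) ×
       (∀ x → EqClosure (Link src P) x (class x)))
  classes src P? [] = id , (λ ()) , λ _ → ε
  classes {n} src {P} P? (i ∷ is) with classes src P? is | P? i
  ... | class , joined , sound | no ¬p = class , joined′ , sound
    where
    joined′ : ∀ {j} → j ∈ i ∷ is → P j → class (src (j , false)) ≡ class (src (j , true))
    joined′ (here refl) p = contradiction p ¬p
    joined′ (there j∈)  p = joined j∈ p
  ... | class , joined , sound | yes p = merge ∘ class , joined′ , merged
    where
    a b : Fin n
    a = src (i , false)
    b = src (i , true)
    merge : Fin n → Fin n
    merge c with c Fin.≟ class a
    ... | yes _ = class b
    ... | no _  = c
    merge-yes : ∀ {c} → c ≡ class a → merge c ≡ class b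
    merge-yes {c} eq with c Fin.≟ class a
    ... | yes _ = refl
    ... | no ≢a = contradiction eq ≢a
    merge-b : merge (class b) ≡ class b
    merge-b with class b Fin.≟ class a
    ... | yes _ = refl
    ... | no _  = refl
    joined′ : ∀ {j} → j ∈ i ∷ is → P j →
      merge (class (src (j , false))) ≡ merge (class (src (j , true)))
    joined′ (here refl) _ = trans (merge-yes refl) (sym merge-b)
    joined′ (there j∈)  q = cong merge (joined j∈ q)
    merged : ∀ x → EqClosure (Link src P) x (merge (class x))
    merged x with class x Fin.≟ class a
    ... | no _   = sound x
    ... | yes eq = subst (EqClosure (Link src P) x) eq (sound x)
      ◅◅ Eq.symmetric _ (sound a) ◅◅ linked (i , false) p ◅◅ sound b

-- Tree and cotree

module _ (G : PlaneGraph) where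
  open PlaneGraph G

  private
    turn-injective : ∀ {d d′} → turn d ≡ turn d′ → d ≡ d′
    turn-injective eq = trans (sym (Inverse.strictlyInverseʳ rotation _))
      (trans (cong (Inverse.from rotation) eq) (Inverse.strictlyInverseʳ rotation _))

    turns : ℕ → Dart → Dart
    turns zero    d = d
    turns (suc k) d = turn (turns k d)

    turns-cancel : ∀ k l d → turns (k + l) d ≡ turns k d → turns l d ≡ d
    turns-cancel zero    l d eq = eq
    turns-cancel (suc k) l d eq = turns-cancel k l d (turn-injective eq)

    bit : Bool → Fin 2
    bit false = zero
    bit true  = suc zero

    bit-injective : ∀ {a b} → bit a ≡ bit b → a ≡ b
    bit-injective {false} {false} _ = refl
    bit-injective {true}  {true}  _ = refl

    -- There are finitely many darts, so two iterates agree, and injectivity of `turn` cancels their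
    -- common part.
    turns-return : ∀ d → ∃[ k ] turns (suc k) d ≡ d
    turns-return d with pigeonhole (n<1+n (#E * 2))
      (λ k → let i , b = turns (toℕ k) d in combine i (bit b))
    ... | k , l , k<l , eq with combine-injective _ _ _ _ eq | m≤n⇒∃[o]m+o≡n k<l
    ...   | e₁ , e₂ | o , e = o , turns-cancel (toℕ k) (suc o) d
      (trans (cong (λ l → turns l d) (trans (+-suc (toℕ k) o) e))
        (sym (cong₂ _,_ e₁ (bit-injective e₂))))

    tail-turn : ∀ d → tail (turn d) ≡ tail d
    tail-turn d = sym (Equivalence.from (tail-orbit d (turn d)) (Eq.return refl))

    rep : Component → Vertex
    rep c = proj₁ (component-surjective c)

    component-rep : ∀ c → component (rep c) ≡ c
    component-rep c = proj₂ (component-surjective c)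

  -- A spanning forest of the vertices uses #V − #C edges.  If the faces are
  -- relabelled such that labels agree along each edge, then the labels are still
  -- connected through the remaining edges, which gives a tree on the labels.
  module TreeCotree
    (P : Fin #E → Set) (P? : Decidable P)
    (spanning : ∀ u v → component u ≡ component v → EqClosure (Link tail P) u v)
    {n : ℕ} (label : Vertex → Face → Fin n)
    (label-edge : ∀ d → label (tail (rev d)) (left d) ≡ label (tail d) (left d))
    where

    private
      reach : ∀ v → ∃[ r ] (rep (component r) ≡ r × EqClosure (Link tail P) v r)
      reach v = rep (component v) , cong rep (component-rep (component v)) ,
        spanning v _ (sym (component-rep (component v)))

    module Tree = Forest tail P P? (λ v → rep (component v) ≡ v) (λ v → _ Fin.≟ v) reach

    InTree : Fin #E → Set
    InTree i = ∃[ v ] Tree.parentEdge v ≡ just i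

    InTree? : Decidable InTree
    InTree? i = any? λ v → Maybe.≡-dec Fin._≟_ (Tree.parentEdge v) (just i)

    side : Dart → Fin n
    side d = label (tail d) (left d)

    -- This is `left-walk` at `rev d`: turning past a dart means crossing its edge.
    side-turn : ∀ d → side (turn d) ≡ side (rev d)
    side-turn d = trans (cong₂ label (trans (tail-turn d) (cong tail (sym (reverse² d))))
      (trans (cong (left ∘ turn) (sym (reverse² d))) (left-walk (rev d))))
      (label-edge (rev d))

    infix 4 _~_
    _~_ : Fin n → Fin n → Set
    _~_ = EqClosure (Link side (λ i → ¬ InTree i))

    ~-reflexive : ∀ {x y} → x ≡ y → x ~ y
    ~-reflexive refl = ε

    ~-sym : ∀ {x y} → x ~ y → y ~ x
    ~-sym = Eq.symmetric _

    -- A full rotation from `turn p` back to `p` crosses every edge at the vertex except that of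
    -- `p`, and so joins the two sides of `p` the long way round.
    around-vertex : ∀ p → (∀ d → tail d ≡ tail p → d ≢ p → side d ~ side (rev d)) →
      side (rev p) ~ side p
    around-vertex p cross with turns-return p
    ... | k , returns = subst₂ _~_ (side-turn p) (cong side returns) (rotate k)
      where
      tail-turns : ∀ k → tail (turns k p) ≡ tail p
      tail-turns zero    = refl
      tail-turns (suc k) = trans (tail-turn (turns k p)) (tail-turns k)
      rotate : ∀ k → side (turn p) ~ side (turns (suc k) p)
      rotate zero = ε
      rotate (suc k) with ×-≡-dec Fin._≟_ Bool._≟_ (turns (suc k) p) p
      -- The return found by `turns-return` need not be the first; after an earlier one the walk
      -- starts afresh from `turn p`.
      ... | yes eq = ~-reflexive (cong (side ∘ turn) (sym eq))
      ... | no ≢p  = rotate k ◅◅ cross (turns (suc k) p) (tail-turns (suc k)) ≢p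
        ◅◅ ~-reflexive (sym (side-turn (turns (suc k) p)))

    private
      deepest : ℕ
      deepest = proj₁ (bounded Tree.depth)

    -- Deleting the leaves of the tree one after the other, every tree edge becomes
    -- the only remaining tree edge at some vertex, and a rotation around that
    -- vertex connects its sides.
    cross-tree : ∀ k v {d} → deepest < Tree.depth v + k →
      Tree.parentEdge v ≡ just (proj₁ d) → side d ~ side (rev d)
    cross-tree zero v b< _ =
      contradiction (subst (deepest <_) (+-identityʳ _) b<) (≤⇒≯ (proj₂ (bounded Tree.depth) v))
    cross-tree (suc k) v {d} b< eq with Tree.parentEdge-just eq
    ... | p , (_ , refl , v>) , e , _ = orient (same-edge d p (sym e))
      where
      others : ∀ d′ → tail d′ ≡ tail p → d′ ≢ p → side d′ ~ side (rev d′)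
      others d′ tails d′≢p with InTree? (proj₁ d′)
      ... | no ¬t = linked d′ ¬t
      ... | yes (w , eq′) with Tree.parentEdge-just eq′
      ...   | q , (_ , refl , w>) , e′ , _ with same-edge q d′ e′
      -- Here `d′` leads to a child, one level deeper, so less fuel suffices. In the other case its
      -- edge is the parent edge of `v` itself, hence that of `p`.
      ...     | inj₂ refl = cross-tree k (tail q)
        (subst (deepest <_) (trans (+-suc _ k) (cong (_+ k) (sym deeper))) b<) eq′
        where
        deeper : Tree.depth (tail q) ≡ suc (Tree.depth (tail p))
        deeper = trans w> (cong (suc ∘ Tree.depth) (trans (cong tail (reverse² d′)) tails))
      ...     | inj₁ refl with same-edge q p (just-injective (trans (sym eq′)
                (trans (cong Tree.parentEdge tails) (trans eq (cong just (sym e))))))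
      ...       | inj₁ q≡p = contradiction q≡p d′≢p
      ...       | inj₂ refl = contradiction
        (trans v> (cong (suc ∘ Tree.depth) tails)) (m≢1+n+m _ {0})
      orient : d ≡ p ⊎ d ≡ rev p → side d ~ side (rev d)
      orient (inj₁ refl) = ~-sym (around-vertex p others)
      orient (inj₂ refl) = around-vertex p others ◅◅ ~-reflexive (cong side (sym (reverse² p)))

    cross : ∀ d → side d ~ side (rev d)
    cross d with InTree? (proj₁ d)
    ... | no ¬t        = linked d ¬t
    ... | yes (v , eq) = cross-tree (suc deepest) v
      (m≤n+m _ (Tree.depth v)) eq

    _On_ : Vertex → Fin n → Set
    v On x = ∃[ f ] (v OnBoundaryOf f × label v f ≡ x)

    LabelMeet : Fin n → Fin n → Set
    LabelMeet x y = ∃[ u ] ∃[ v ] (u On x × v On y × component u ≡ component v)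

    dart-on : ∀ d → tail d On side d
    dart-on d = left d , inj₁ (d , refl , refl) , refl

    turn-~ : ∀ {d d′} → turn d ≡ d′ → side d ~ side d′
    turn-~ {d} refl = cross d ◅◅ ~-reflexive (sym (side-turn d))

    -- The darts at a vertex form one orbit and each turn crosses an edge; an isolated vertex lies
    -- in a single face.
    on-same-vertex : ∀ {v x y} → v On x → v On y → x ~ y
    on-same-vertex (_ , inj₁ (d , refl , refl) , refl) (_ , inj₁ (d′ , tails , refl) , refl) =
      Eq.gfold (Eq.isEquivalence _) side turn-~ (Equivalence.to (tail-orbit d d′) (sym tails))
      ◅◅ ~-reflexive (cong (λ v → label v (left d′)) tails)
    on-same-vertex (_ , inj₁ (d , tails , _) , _) (_ , inj₂ (isolated , _) , _) =
      contradiction tails (isolated d)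
    on-same-vertex (_ , inj₂ (isolated , _) , _) (_ , inj₁ (d , tails , _) , _) =
      contradiction tails (isolated d)
    on-same-vertex (_ , inj₂ (_ , refl) , refl) (_ , inj₂ (_ , refl) , refl) = ε

    on-same-component : ∀ {u v x y} → EqClosure Adjacent u v → u On x → v On y → x ~ y
    on-same-component ε ux vy = on-same-vertex ux vy
    on-same-component (fwd (d , refl , refl) ◅ path) ux vy =
      on-same-vertex ux (dart-on d) ◅◅ cross d ◅◅ on-same-component path (dart-on (rev d)) vy
    on-same-component (bwd (d , refl , refl) ◅ path) ux vy =
      on-same-vertex ux (dart-on (rev d)) ◅◅ ~-sym (cross d) ◅◅ on-same-component path (dart-on d) vy

    module Cotree (x₀ : Fin n) (connected : ∀ x → EqClosure LabelMeet x x₀) where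

      connected-~ : ∀ x → ∃[ y ] (y ≡ x₀ × x ~ y)
      connected-~ x = x₀ , refl , Eq.fold (Eq.isEquivalence _) meet-~ (connected x)
        where
        meet-~ : ∀ {x y} → LabelMeet x y → x ~ y
        meet-~ (u , v , ux , vy , same) =
          on-same-component (Equivalence.to (component-connected u v) same) ux vy

      module Dual = Forest side (λ i → ¬ InTree i) (¬? ∘ InTree?) (_≡ x₀) (Fin._≟ x₀) connected-~

      -- Counts both forests at once: vertices and labels go to their parent edges, roots of the
      -- tree to their components, and the root of the cotree to the extra point. Injectivity holds
      -- because the cotree avoids the edges of the tree.
      code : Fin #V ⊎ Fin n → Fin #E ⊎ Fin #C ⊎ Fin 1
      code (inj₁ v) = maybe′ inj₁ (inj₂ (inj₁ (component v))) (Tree.parentEdge v)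
      code (inj₂ x) = maybe′ inj₁ (inj₂ (inj₂ zero)) (Dual.parentEdge x)

      code-injective : ∀ {a b} → code a ≡ code b → a ≡ b
      code-injective {inj₁ v} {inj₁ w} eq
        with Tree.parentEdge v in eq₁ | Tree.parentEdge w in eq₂
      ... | just i  | just j  = cong inj₁ (Tree.parentEdge-injective eq₁
        (trans eq₂ (cong just (sym (inj₁-injective eq)))))
      ... | nothing | nothing = cong inj₁ (trans (sym (Tree.parentEdge-nothing eq₁))
        (trans (cong rep (inj₁-injective (inj₂-injective eq))) (Tree.parentEdge-nothing eq₂)))
      code-injective {inj₁ v} {inj₂ x} eq
        with Tree.parentEdge v in eq₁ | Dual.parentEdge x in eq₂
      ... | just i | just j = contradiction
        (v , trans eq₁ (cong just (inj₁-injective eq))) (Dual.parentEdge-P eq₂)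
      ... | nothing | nothing = contradiction (inj₂-injective eq) λ ()
      code-injective {inj₂ x} {inj₁ v} eq
        with Dual.parentEdge x in eq₁ | Tree.parentEdge v in eq₂
      ... | just i | just j = contradiction
        (v , trans eq₂ (cong just (sym (inj₁-injective eq)))) (Dual.parentEdge-P eq₁)
      ... | nothing | nothing = contradiction (inj₂-injective eq) λ ()
      code-injective {inj₂ x} {inj₂ y} eq
        with Dual.parentEdge x in eq₁ | Dual.parentEdge y in eq₂
      ... | just i  | just j  = cong inj₂ (Dual.parentEdge-injective eq₁
        (trans eq₂ (cong just (sym (inj₁-injective eq)))))
      ... | nothing | nothing = cong inj₂
        (trans (Dual.parentEdge-nothing eq₁) (sym (Dual.parentEdge-nothing eq₂)))

      private
        encode : Fin #E ⊎ Fin #C ⊎ Fin 1 → Fin (#E + (#C + 1))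
        encode = join #E (#C + 1) ∘ Sum.map₂ (join #C 1)

        decode : Fin (#E + (#C + 1)) → Fin #E ⊎ Fin #C ⊎ Fin 1
        decode = Sum.map₂ (splitAt #C) ∘ splitAt #E

        decode-encode : ∀ s → decode (encode s) ≡ s
        decode-encode (inj₁ i) rewrite splitAt-join #E (#C + 1) (inj₁ i) = refl
        decode-encode (inj₂ s) rewrite splitAt-join #E (#C + 1) (inj₂ (join #C 1 s)) =
          cong inj₂ (splitAt-join #C 1 s)

        count : Fin (#V + n) → Fin (#E + (#C + 1))
        count = encode ∘ code ∘ splitAt #V

        count-injective : ∀ {i j} → count i ≡ count j → i ≡ j
        count-injective {i} {j} eq = trans (sym (join-splitAt #V n i)) (trans
          (cong (join #V n) (code-injective {splitAt #V i} {splitAt #V j}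
            (trans (sym (decode-encode (code (splitAt #V i))))
              (trans (cong decode eq) (decode-encode (code (splitAt #V j)))))))
          (join-splitAt #V n j))

      euler-≤ : #V + n ≤ #E + (#C + 1)
      euler-≤ = injective⇒≤ count-injective

      -- With equal cardinalities the injection `code` is onto, so it hits every edge.
      tree-or-cotree : #V + n ≡ #E + (#C + 1) → ∀ i →
        InTree i ⊎ (∃[ x ] Dual.parentEdge x ≡ just i)
      tree-or-cotree eq i = find (onto eq count count-injective (encode (inj₁ i)))
        where
        onto : ∀ {m n} → m ≡ n → (f : Fin m → Fin n) → (∀ {i j} → f i ≡ f j → i ≡ j) →
          ∀ y → ∃[ x ] f x ≡ y
        onto refl f f-inj = injective⇒surjective f-inj
        covered : ∀ s → code s ≡ inj₁ i → InTree i ⊎ (∃[ x ] Dual.parentEdge x ≡ just i)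
        covered (inj₁ v) e with Tree.parentEdge v in eq₁
        ... | just j = inj₁ (v , trans eq₁ (cong just (inj₁-injective e)))
        covered (inj₂ x) e with Dual.parentEdge x in eq₁
        ... | just j = inj₂ (x , trans eq₁ (cong just (inj₁-injective e)))
        find : ∃[ k ] count k ≡ encode (inj₁ i) → _
        find (k , e) = covered (splitAt #V k)
          (trans (sym (decode-encode (code (splitAt #V k))))
            (trans (cong decode e) (decode-encode (inj₁ i))))

  -- Outerplanar maps and the edges of the outer face

  OuterEdge : Fin #E → Set
  OuterEdge i = left (i , false) ≡ outer ⊎ left (i , true) ≡ outer

  OuterEdge? : Decidable OuterEdge
  OuterEdge? i = (left (i , false) Fin.≟ outer) ⊎-dec (left (i , true) Fin.≟ outer)

  outerEdge : ∀ d → left d ≡ outer → OuterEdge (proj₁ d)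
  outerEdge (i , false) = inj₁
  outerEdge (i , true)  = inj₂

  -- Otherwise the outer face could be split in two without changing anything
  -- else, and there would be one face too many for Euler's formula.
  module OuterConnected (outerplanar : Outerplanar) where

    private
      outerClasses = classes tail OuterEdge? (allFin #E)

    class : Vertex → Vertex
    class = proj₁ outerClasses

    class-edge : ∀ d → left d ≡ outer → class (tail d) ≡ class (tail (rev d))
    class-edge (i , false) eq = proj₁ (proj₂ outerClasses) (∈-allFin i) (inj₁ eq)
    class-edge (i , true)  eq = sym (proj₁ (proj₂ outerClasses) (∈-allFin i) (inj₂ eq))

    class-sound : ∀ v → EqClosure (Link tail OuterEdge) v (class v)
    class-sound = proj₂ (proj₂ outerClasses)

    module Split (u v : Vertex) (same : component u ≡ component v) (differ : class u ≢ class v) where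

      -- The new face `zero` is the outer face as seen from the class of `u`; `suc outer` is the
      -- rest of it.
      split : Vertex → Face → Fin (suc #F)
      split c f with f Fin.≟ outer | c Fin.≟ class u
      ... | yes _ | yes _ = zero
      ... | _     | _     = suc f

      split-zero : split (class u) outer ≡ zero
      split-zero with outer Fin.≟ outer | class u Fin.≟ class u
      ... | yes _ | yes _ = refl
      ... | no ≢  | _     = contradiction refl ≢
      ... | yes _ | no ≢  = contradiction refl ≢

      split-other : ∀ {c} → c ≢ class u → split c outer ≡ suc outer
      split-other {c} ≢u with outer Fin.≟ outer | c Fin.≟ class u
      ... | yes _ | yes eq = contradiction eq ≢u
      ... | no _  | _      = refl
      ... | yes _ | no _   = refl

      split-inner : ∀ c {f} → f ≢ outer → split c f ≡ suc f
      split-inner c {f} ≢outer with f Fin.≟ outer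
      ... | yes eq = contradiction eq ≢outer
      ... | no _   = refl

      label : Vertex → Face → Fin (suc #F)
      label w = split (class w)

      -- The ends of an edge on the outer face share a class, so they see the same half.
      label-edge : ∀ d → label (tail (rev d)) (left d) ≡ label (tail d) (left d)
      label-edge d = by (left d Fin.≟ outer)
        where
        by : Dec (left d ≡ outer) → label (tail (rev d)) (left d) ≡ label (tail d) (left d)
        by (yes eq) = cong (λ c → split c (left d)) (sym (class-edge d eq))
        by (no ≢outer) = trans (split-inner (class (tail (rev d))) ≢outer)
          (sym (split-inner (class (tail d)) ≢outer))

      open TreeCotree (λ _ → ⊤) (λ _ → yes tt)
        (λ u v → Eq.map (λ (d , s , t) → d , tt , s , t) ∘ Equivalence.to (component-connected u v))
        label label-edge using (LabelMeet; module Cotree)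

      -- Keeps the faces connected after the split: `u` and `v` lie in one component, and each sees
      -- a different half.
      halves-meet : LabelMeet zero (suc outer)
      halves-meet = u , v , (outer , outerplanar u , split-zero) ,
        (outer , outerplanar v , split-other (differ ∘ sym)) , same

      suc-label : ∀ w f → EqClosure LabelMeet (suc f) (label w f)
      suc-label w f with f Fin.≟ outer | class w Fin.≟ class u
      ... | yes refl | yes _ = Eq.symmetric _ (Eq.return halves-meet)
      ... | yes _    | no _  = ε
      ... | no _     | _     = ε

      suc-connected : ∀ f g → EqClosure LabelMeet (suc f) (suc g)
      suc-connected f g = Eq.gfold (Eq.isEquivalence LabelMeet) suc
        (λ {f} {g} (w , w′ , wf , w′g , eq) → suc-label w f
          ◅◅ Eq.return (w , w′ , (f , wf , refl) , (g , w′g , refl) , eq)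
          ◅◅ Eq.symmetric _ (suc-label w′ g))
        (faces-connected f g)

      connected : ∀ x → EqClosure LabelMeet x (suc outer)
      connected zero    = Eq.return halves-meet
      connected (suc f) = suc-connected f outer

      impossible : ⊥
      impossible = 1+n≰n (begin
        suc (#E + (#C + 1)) ≡⟨ cong suc (+-assoc #E #C 1) ⟨
        suc (#E + #C + 1)   ≡⟨ cong suc euler ⟨
        suc (#V + #F)       ≡⟨ +-suc #V #F ⟨
        #V + suc #F         ≤⟨ Cotree.euler-≤ (suc outer) connected ⟩
        #E + (#C + 1)       ∎)
        where open ≤-Reasoning

    outer-connected : ∀ u v → component u ≡ component v → EqClosure (Link tail OuterEdge) u v
    outer-connected u v same with class u Fin.≟ class v
    ... | yes eq = class-sound u ◅◅ subst (λ w → EqClosure (Link tail OuterEdge) w v) (sym eq)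
      (Eq.symmetric _ (class-sound v))
    ... | no ≢   = contradiction (Split.impossible u v same ≢) id

  -- Since the tree can be chosen among the edges of the outer face, the cotree
  -- contains all other edges.
  module Outerplanarity (outerplanar : Outerplanar) where

    open TreeCotree OuterEdge OuterEdge? (OuterConnected.outer-connected outerplanar)
      (λ _ f → f) (λ _ → refl)

    open Cotree outer
      (λ f → Eq.map
        (λ (u , v , uf , vg , same) → u , v , (_ , uf , refl) , (_ , vg , refl) , same)
        (faces-connected f outer))

    open Dual public using (depth; parent)

    inner-treeEdge : ∀ {f g} → ShareEdge f g → f ≢ outer → g ≢ outer → f ≢ g →
      TreeEdge depth parent f g
    inner-treeEdge (d@(i , b) , refl , refl) f≢o g≢o _
      with tree-or-cotree (trans euler (+-assoc #E #C 1)) i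
    -- Tree edges border the outer face, but neither side of this edge is outer.
    ... | inj₁ (v , eq) = contradiction (Tree.parentEdge-P eq) (inner b f≢o g≢o)
      where
      inner : ∀ b → left (i , b) ≢ outer → left (i , not b) ≢ outer → ¬ OuterEdge i
      inner false f≢ g≢ = [ f≢ , g≢ ]′
      inner true  f≢ g≢ = [ g≢ , f≢ ]′
    ... | inj₂ (x , eq) with Dual.parentEdge-just eq
    ...   | p , (_ , refl , deeper) , e , par with same-edge p d e
    ...     | inj₁ refl = inj₁ (par , deeper)
    ...     | inj₂ refl = inj₂
      (trans par (cong left (reverse² d)) , trans deeper (cong (suc ∘ depth ∘ left) (reverse² d)))

-- The five colours and the theorem

fiveColours : Maybe (Maybe (Maybe Bool)) → Fin 5
fiveColours nothing                    = 0F
fiveColours (just nothing)             = 1F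
fiveColours (just (just nothing))      = 2F
fiveColours (just (just (just false))) = 3F
fiveColours (just (just (just true)))  = 4F

fiveColours-injective : ∀ {a b} → fiveColours a ≡ fiveColours b → a ≡ b
fiveColours-injective {a} {b} eq = trans (sym (retract a)) (trans (cong back eq) (retract b))
  where
  back : Fin 5 → Maybe (Maybe (Maybe Bool))
  back 0F = nothing
  back 1F = just nothing
  back 2F = just (just nothing)
  back 3F = just (just (just false))
  back 4F = just (just (just true))
  retract : ∀ a → back (fiveColours a) ≡ a
  retract nothing                    = refl
  retract (just nothing)             = refl
  retract (just (just nothing))      = refl
  retract (just (just (just false))) = refl
  retract (just (just (just true)))  = refl

theorem1 : (G : PlaneGraph) → let open PlaneGraph G in
    Outerplanar →
    Σ[ colour ∈ (Face → Fin 5) ] NonRepetitiveColouring colour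
theorem1 G outerplanar =
  fiveColours ∘ rootedColour depth parent Fin._≟_ outer ,
  rootedColour-nonRepetitive depth parent Fin._≟_ outer ShareEdge inner-treeEdge
    fiveColours fiveColours-injective
  where
  open PlaneGraph G
  open Outerplanarity G outerplanar
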